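{- Let $(W,S)$ be a Coxeter system and $u,v\in W$ with $u\leq_R v$. Then $$T_L(v)=T_L(u)\cup\bigcup_{s\in D_R(u^{ -1}v)}T_L\big(v^{S\setminus\{s\}}\big).$$
   Context: $\ell$ is the length function of $W$, $T=\{wsw^{ -1}:w\in W,s\in S\}$ the set of reflections, $T_L(w)=\{t\in T:\ell(tw)<\ell(w)\}$, $D_R(w)=\{s\in S:\ell(ws)<\ell(w)\}$. The right weak order $\leq_R$ is the partial order generated by $x<_R xs$ whenever $s\in S$ and $\ell(xs)>\ell(x)$; equivalently $u\le_R v$ iff $\ell(v)=\ell(u)+\ell(u^{ -1}v)$. For $J\subseteq S$, $W^J=\{w\in W:\ell(w)<\ell(ws)\ \forall s\in J\}$, and every $w\in W$ factors uniquely as $w=w^Jw_J$ with $w^J\in W^J$, $w_J$ in the subgroup generated by $J$, and $\ell(w)=\ell(w^J)+\ell(w_J)$. -}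

module Defs where

open import Level using (Level; _⊔_; suc; 0ℓ)
open import Algebra.Bundles using (Group)
open import Algebra.Morphism.Structures using (module GroupMorphisms)
open import Data.Nat using (ℕ; zero; _+_; _<_; _≤_)
  renaming (suc to 1+)
open import Data.Maybe using (Maybe; just; nothing)
open import Data.List using (List; []; _∷_; length)
open import Data.List.Relation.Unary.All using (All)
open import Data.Product using (Σ; ∃; _×_; _,_)
open import Data.Empty using (⊥)
open import Relation.Binary.PropositionalEquality using (_≡_; _≢_)
open import Relation.Nullary using (¬_)

module _ {c ℓ : Level} (G : Group c ℓ) where
  open Group G
  pow : Carrier → ℕ → Carrier
  pow x zero = ε
  pow x (1+ n) = x ∙ pow x n

wordProd : {c ℓ : Level} (G : Group c ℓ) {I : Set} → (I → Group.Carrier G) → List I → Group.Carrier G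
wordProd G gen [] = Group.ε G
wordProd G gen (i ∷ is) = Group._∙_ G (gen i) (wordProd G gen is)

-- A Coxeter system (W,S): W a group, S = { gen i : i ∈ I }, and W is
-- presented by the generators S subject to (s s')^{m(s,s')} = 1, where
-- m is a Coxeter matrix (nothing = ∞, i.e. no relation).
record CoxeterSystem (c ℓ : Level) : Set (suc (c ⊔ ℓ)) where
  field
    W   : Group c ℓ
    I   : Set
    gen : I → Group.Carrier W
    m   : I → I → Maybe ℕ
  open Group W
  field
    m-diag  : ∀ i → m i i ≡ just 1
    m-sym   : ∀ i j → m i j ≡ m j i
    m-off   : ∀ i j → i ≢ j → ∀ k → m i j ≡ just k → 2 ≤ k
    rel     : ∀ i j k → m i j ≡ just k → pow W (gen i ∙ gen j) k ≈ ε
    generated : ∀ w → ∃ λ (is : List I) → wordProd W gen is ≈ w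
    universal : (H : Group c ℓ) (f : I → Group.Carrier H) →
      (∀ i j k → m i j ≡ just k →
         Group._≈_ H (pow H (Group._∙_ H (f i) (f j)) k) (Group.ε H)) →
      Σ (Carrier → Group.Carrier H) λ φ →
        GroupMorphisms.IsGroupHomomorphism (Group.rawGroup W) (Group.rawGroup H) φ
        × (∀ i → Group._≈_ H (φ (gen i)) (f i))
        × ((ψ : Carrier → Group.Carrier H) →
           GroupMorphisms.IsGroupHomomorphism (Group.rawGroup W) (Group.rawGroup H) ψ →
           (∀ i → Group._≈_ H (ψ (gen i)) (f i)) →
           ∀ w → Group._≈_ H (φ w) (ψ w))

module _ {c ℓ : Level} (C : CoxeterSystem c ℓ) where
  open CoxeterSystem C
  open Group W

  prod : List I → Carrier
  prod = wordProd W gen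

  IsLengthFunction : (Carrier → ℕ) → Set (c ⊔ ℓ)
  IsLengthFunction len = ∀ w →
    (∃ λ (is : List I) → prod is ≈ w × length is ≡ len w)
    × (∀ (is : List I) → prod is ≈ w → len w ≤ length is)

  IsReflection : Carrier → Set (c ⊔ ℓ)
  IsReflection t = ∃ λ (w : Carrier) → ∃ λ (i : I) → t ≈ (w ∙ gen i) ∙ w ⁻¹

  module _ (len : Carrier → ℕ) where
    TL : Carrier → Carrier → Set (c ⊔ ℓ)
    TL w t = IsReflection t × len (t ∙ w) < len w

    DR : Carrier → I → Set
    DR w i = len (w ∙ gen i) < len w

    _≤R_ : Carrier → Carrier → Set
    u ≤R v = len v ≡ len u + len (u ⁻¹ ∙ v)

    InParabolic : (I → Set) → Carrier → Set ℓ
    InParabolic J w = ∃ λ (is : List I) → All J is × prod is ≈ w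

    MinimalRep : (I → Set) → Carrier → Set
    MinimalRep J x = ∀ j → J j → len x < len (x ∙ gen j)

    IsParabolicPart : (I → Set) → Carrier → Carrier → Set (c ⊔ ℓ)
    IsParabolicPart J w x = MinimalRep J x ×
      ∃ λ (y : Carrier) → InParabolic J y × w ≈ x ∙ y × len w ≡ len x + len y

    SMinus : I → I → Set
    SMinus i j = j ≢ i

{-# OPTIONS --safe #-}

-- A reflection t lies in T_L(w) iff it occurs an odd number of times among the reflections
-- s₁⋯sₖ₋₁ sₖ sₖ₋₁⋯s₁ of a word s₁⋯sₙ for w; this parity N(w,t) is a cocycle,
-- N(xy,t) = N(x,t) + N(y,x⁻¹tx), and gives the strong exchange condition.
-- Let v = uz with t in T_L(v) but not in T_L(u), and put q = v⁻¹tv. Then u⁻¹tu is in T_L(z), so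
-- ℓ(zq) < ℓ(z), hence some letter s of a reduced word of q is a right descent of z. Write
-- v = xy with x = v^{S∖s} and y in W_{S∖s}. If t were not in T_L(x), then x⁻¹tx would be in
-- T_L(y), so that q = y⁻¹(x⁻¹tx)y would be in W_{S∖s} and have no reduced word containing s.
-- The last step needs the generators to be distinct in W, which a presentation only
-- guarantees through a representation; the one used here is integral.
module Submission where

open import Defs
open import Level using (Level; Lift; lift; lower)
open import Algebra.Bundles using (Group)
open import Algebra.Morphism.Structures using (module GroupMorphisms)
import Algebra.Properties.Group as GroupProperties
open import Data.Bool using (Bool; true; false; if_then_else_; _xor_)
import Data.Bool.Properties as Bool
open import Data.Integer as ℤ using (ℤ; 0ℤ; 1ℤ)
open import Data.Integer.Properties using (*-zeroˡ)
open import Data.Integer.Tactic.RingSolver using (solve-∀)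
open import Data.List using (List; []; _∷_; _++_; _∷ʳ_; length; reverse; [_]; initLast; _∷ʳ′_)
open import Data.List.Membership.Propositional using (_∈_; find)
import Data.List.Properties as List
open import Data.List.Relation.Binary.Sublist.Propositional
  using (_⊆_; []; _∷_; ⊆-refl; ⊆-trans) renaming (_∷ʳ_ to _omit_)
open import Data.List.Relation.Binary.Sublist.Propositional.Properties
  using (All-resp-⊆; Any-resp-⊆; length-mono-≤)
open import Data.List.Relation.Unary.All as All using (All; []; _∷_)
import Data.List.Relation.Unary.All.Properties as All
open import Data.List.Relation.Unary.Any as Any using (Any; here)
import Data.List.Relation.Unary.Any.Properties as Any
open import Data.Maybe using (Maybe; just; nothing)
import Data.Maybe.Properties as Maybe
open import Data.Nat using (ℕ; zero; suc; _+_; _*_; _<_; _≤_; z≤n; s≤s; s≤s⁻¹; _<?_)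
open import Data.Nat.Divisibility
  using (_∣_; _∣?_; ∣-refl; 1∣_; >⇒∤; ∣m+n∣m⇒∣n; ∣m∣n⇒∣m+n; n∣m*n)
open import Data.Nat.DivMod using (_/_; _%_; m≡m%n+[m/n]*n; m%n<n)
import Data.Nat.Properties as ℕ
open import Data.Product using (∃; ∃-syntax; _×_; _,_; proj₁; proj₂)
open import Data.Sum using (_⊎_; inj₁; inj₂)
open import Function using (_∘_)
open import Function.Bundles using (_⇔_; mk⇔)
open import Relation.Binary using (Rel; IsEquivalence)
open import Relation.Binary.PropositionalEquality as ≡
  using (_≡_; _≢_; _≗_; refl; cong; cong₂; subst; module ≡-Reasoning)
import Relation.Binary.Reasoning.Setoid as SetoidReasoning
open import Relation.Nullary using (¬_; Dec; yes; no; does; contradiction; ¬?; _×-dec_)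
open import Relation.Nullary.Decidable
  using (dec-true; dec-false; does-⇔; decidable-stable; map′)

-- Chebyshev polynomials of linear operators on integer sequences.

module LinearAlgebra where

  V : Set
  V = ℕ → ℤ

  infixl 6 _⊕_ _⊖_
  _⊕_ _⊖_ : V → V → V
  (v ⊕ w) n = v n ℤ.+ w n
  (v ⊖ w) n = v n ℤ.- w n

  𝟎 : V
  𝟎 _ = 0ℤ

  record Linear (f : V → V) : Set where
    field
      cong-≗ : ∀ {v w} → v ≗ w → f v ≗ f w
      add    : ∀ v w → f (v ⊕ w) ≗ f v ⊕ f w

    sub : ∀ v w → f (v ⊖ w) ≗ f v ⊖ f w
    sub v w n = ≡.trans (shift _ _) (cong (ℤ._- f w n)
      (≡.trans (≡.sym (add (v ⊖ w) w n)) (cong-≗ (λ k → unshift (v k) (w k)) n)))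
      where
      shift : ∀ a b → a ≡ a ℤ.+ b ℤ.- b
      shift = solve-∀
      unshift : ∀ a b → a ℤ.- b ℤ.+ b ≡ a
      unshift = solve-∀

    vanish : f 𝟎 ≗ 𝟎
    vanish n = ≡.trans (cong-≗ {w = 𝟎 ⊖ 𝟎} (λ _ → refl) n) (≡.trans (sub 𝟎 𝟎 n) (self (f 𝟎 n)))
      where
      self : ∀ a → a ℤ.- a ≡ 0ℤ
      self = solve-∀

  open Linear

  module Chebyshev {c : V → V} (c-linear : Linear c) where

    -- U n is the Chebyshev polynomial of the second kind evaluated at c/2.
    U : ℕ → V → V
    U zero          v = v
    U (suc zero)    v = c v
    U (suc (suc n)) v = U (suc n) (c v) ⊖ U n v

    U-linear : ∀ n → Linear (U n)
    U-linear zero       = record { cong-≗ = λ eq → eq ; add = λ _ _ _ → refl }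
    U-linear (suc zero) = c-linear
    U-linear (suc (suc n)) = record
      { cong-≗ = λ eq k → cong₂ ℤ._-_ (cong-≗ (U-linear (suc n)) (cong-≗ c-linear eq) k)
                                      (cong-≗ (U-linear n) eq k)
      ; add    = λ v w k → ≡.trans
          (cong₂ ℤ._-_ (≡.trans (cong-≗ (U-linear (suc n)) (add c-linear v w) k)
                              (add (U-linear (suc n)) (c v) (c w) k))
                       (add (U-linear n) v w k))
          (rearrange (U (suc n) (c v) k) _ (U n v k) _)
      }
      where
      rearrange : ∀ a b x y → a ℤ.+ b ℤ.- (x ℤ.+ y) ≡ a ℤ.- x ℤ.+ (b ℤ.- y)
      rearrange = solve-∀

    U-c-comm : ∀ n v → U n (c v) ≗ c (U n v)
    U-c-comm zero          v k = refl
    U-c-comm (suc zero)    v k = refl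
    U-c-comm (suc (suc n)) v k = ≡.trans
      (cong₂ ℤ._-_ (U-c-comm (suc n) (c v) k) (U-c-comm n v k))
      (≡.sym (sub c-linear (U (suc n) (c v)) (U n v) k))

    -- Both are polynomials in the same operator `c`. In `U-path-vanish` this brings `U d` to the
    -- outside, where it is evaluated at a left end.
    U-U-comm : ∀ m n v → U m (U n v) ≗ U n (U m v)
    U-U-comm zero          n v k = refl
    U-U-comm (suc zero)    n v k = ≡.sym (U-c-comm n v k)
    U-U-comm (suc (suc m)) n v k = ≡.trans
      (cong₂ ℤ._-_
        (≡.trans (cong-≗ (U-linear (suc m)) (λ l → ≡.sym (U-c-comm n v l)) k)
               (U-U-comm (suc m) n (c v) k))
        (U-U-comm m n v k))
      (≡.sym (sub (U-linear n) (U (suc m) (c v)) (U m v) k))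

    -- The three-term Chebyshev recurrence with arbitrary initial vectors, the analogue of [2][n] =
    -- [n+1] + [n-1] for quantum integers.
    Recurrent : (ℕ → V) → Set
    Recurrent v = ∀ n → c (v (1 + n)) ≗ v (2 + n) ⊕ v n

    evens : (ℕ → V) → ℕ → V
    evens v zero    = 𝟎
    evens v (suc n) = v 0 ⊕ evens (v ∘ (2 +_)) n

    evens-cong : ∀ {v w} → (∀ n → v n ≗ w n) → ∀ n → evens v n ≗ evens w n
    evens-cong eq zero    k = refl
    evens-cong eq (suc n) k = cong₂ ℤ._+_ (eq 0 k) (evens-cong (eq ∘ (2 +_)) n k)

    -- The analogue of [n]² = [1] + [3] + … + [2n-1] for quantum integers.
    U-evens : ∀ n v → Recurrent v → U n (v n) ≗ evens v (suc n)
    U-evens zero       v r k = unit (v 0 k)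
      where
      unit : ∀ a → a ≡ a ℤ.+ 0ℤ
      unit = solve-∀
    U-evens (suc zero) v r k = ≡.trans (r 0 k) (rearrange (v 2 k) (v 0 k))
      where
      rearrange : ∀ a b → a ℤ.+ b ≡ b ℤ.+ (a ℤ.+ 0ℤ)
      rearrange = solve-∀
    U-evens (suc (suc n)) v r k = begin
      U (suc n) (c (v (2 + n))) k ℤ.- U n (v (2 + n)) k
        ≡⟨ cong (ℤ._- U n (v (2 + n)) k)
             (≡.trans (cong-≗ (U-linear (suc n)) (r (1 + n)) k)
                    (add (U-linear (suc n)) (v (3 + n)) (v (1 + n)) k)) ⟩
      -- The terms at `3 + n` and `2 + n` belong to the sequence shifted by two, and the latter
      -- cancels all of `evens v (2 + n)` but `v 0`.
      U (suc n) (v (3 + n)) k ℤ.+ U (suc n) (v (1 + n)) k ℤ.- U n (v (2 + n)) k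
        ≡⟨ cong₂ ℤ._-_
             (cong₂ ℤ._+_ (U-evens (suc n) (v ∘ (2 +_)) (r ∘ (2 +_)) k) (U-evens (suc n) v r k))
             (U-evens n (v ∘ (2 +_)) (r ∘ (2 +_)) k) ⟩
      evens (v ∘ (2 +_)) (2 + n) k ℤ.+ (v 0 k ℤ.+ evens (v ∘ (2 +_)) (1 + n) k)
        ℤ.- evens (v ∘ (2 +_)) (1 + n) k
        ≡⟨ rearrange (evens (v ∘ (2 +_)) (2 + n) k) (v 0 k) (evens (v ∘ (2 +_)) (1 + n) k) ⟩
      v 0 k ℤ.+ evens (v ∘ (2 +_)) (2 + n) k ∎
      where
      open ≡-Reasoning
      rearrange : ∀ a b x → a ℤ.+ (b ℤ.+ x) ℤ.- x ≡ b ℤ.+ a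
      rearrange = solve-∀

  -- Adjacency operators of disjoint unions of paths.

  -- The weight of the edge {n, 1 + n} of the disjoint union of the paths on
  -- {q d, …, q d + d - 1}, and the adjacency operator of that graph.
  edge : ℕ → ℕ → ℤ
  edge d n = if does (d ∣? suc n) then 0ℤ else 1ℤ

  path : ℕ → V → V
  path d v zero    = edge d 0 ℤ.* v 1
  path d v (suc n) = edge d n ℤ.* v n ℤ.+ edge d (suc n) ℤ.* v (2 + n)

  path-linear : ∀ d → Linear (path d)
  path-linear d = record { cong-≗ = path-cong ; add = path-add }
    where
    path-cong : ∀ {v w} → v ≗ w → path d v ≗ path d w
    path-cong eq zero    = cong (edge d 0 ℤ.*_) (eq 1)
    path-cong eq (suc n) =
      cong₂ (λ a b → edge d n ℤ.* a ℤ.+ edge d (suc n) ℤ.* b) (eq n) (eq (2 + n))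

    distrib : ∀ e a b → e ℤ.* (a ℤ.+ b) ≡ e ℤ.* a ℤ.+ e ℤ.* b
    distrib = solve-∀
    distrib₂ : ∀ e e′ a b x y → e ℤ.* (a ℤ.+ b) ℤ.+ e′ ℤ.* (x ℤ.+ y)
                              ≡ e ℤ.* a ℤ.+ e′ ℤ.* x ℤ.+ (e ℤ.* b ℤ.+ e′ ℤ.* y)
    distrib₂ = solve-∀

    path-add : ∀ v w → path d (v ⊕ w) ≗ path d v ⊕ path d w
    path-add v w zero    = distrib (edge d 0) (v 1) (w 1)
    path-add v w (suc n) =
      distrib₂ (edge d n) (edge d (suc n)) (v n) (w n) (v (2 + n)) (w (2 + n))

  edge-∣ : ∀ {d n} → d ∣ suc n → edge d n ≡ 0ℤ
  edge-∣ {d} {n} p = cong (if_then 0ℤ else 1ℤ) (dec-true (d ∣? suc n) p)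

  edge-inside : ∀ {d n b} → d ∣ b → suc n < d → edge d (n + b) ≡ 1ℤ
  edge-inside {d} {n} {b} d∣b n<d = cong (if_then 0ℤ else 1ℤ)
    (dec-false (d ∣? suc (n + b)) (λ p → >⇒∤ n<d (∣m+n∣n⇒∣m (suc n) p d∣b)))
    where
    ∣m+n∣n⇒∣m : ∀ m → d ∣ m + b → d ∣ b → d ∣ m
    ∣m+n∣n⇒∣m m p q = ∣m+n∣m⇒∣n (subst (d ∣_) (ℕ.+-comm m b) p) q

  path-left-end : ∀ {d b} → d ∣ b → 1 < d → ∀ v → path d v b ≡ v (1 + b)
  path-left-end {d} {zero}  d∣b 1<d v =
    ≡.trans (cong (ℤ._* v 1) (edge-inside {n = 0} d∣b 1<d)) (unit (v 1))
    where
    unit : ∀ a → 1ℤ ℤ.* a ≡ a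
    unit = solve-∀
  path-left-end {d} {suc b} d∣b 1<d v =
    ≡.trans (cong₂ (λ e e′ → e ℤ.* v b ℤ.+ e′ ℤ.* v (2 + b)) (edge-∣ d∣b) (edge-inside {n = 0} d∣b 1<d))
          (unit (v b) (v (2 + b)))
    where
    unit : ∀ a b → 0ℤ ℤ.* a ℤ.+ 1ℤ ℤ.* b ≡ b
    unit = solve-∀

  path-inside : ∀ {d b n} → d ∣ b → 2 + n < d → ∀ v →
                path d v (1 + n + b) ≡ v (n + b) ℤ.+ v (2 + n + b)
  path-inside {d} {b} {n} d∣b lt v = ≡.trans
    (cong₂ (λ e e′ → e ℤ.* v (n + b) ℤ.+ e′ ℤ.* v (2 + n + b))
      (edge-inside d∣b (ℕ.<-trans (ℕ.n<1+n _) lt)) (edge-inside {n = suc n} d∣b lt))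
    (unit (v (n + b)) (v (2 + n + b)))
    where
    unit : ∀ a b → 1ℤ ℤ.* a ℤ.+ 1ℤ ℤ.* b ≡ a ℤ.+ b
    unit = solve-∀

  path-right-end : ∀ {d b} → d ∣ b → ∀ n → 2 + n ≡ d → ∀ v → path d v (1 + n + b) ≡ v (n + b)
  path-right-end {d} {b} d∣b n refl v = ≡.trans
    (cong₂ (λ e e′ → e ℤ.* v (n + b) ℤ.+ e′ ℤ.* v (2 + n + b))
      (edge-inside d∣b ℕ.≤-refl) (edge-∣ (∣m∣n⇒∣m+n ∣-refl d∣b)))
    (unit (v (n + b)) (v (2 + n + b)))
    where
    unit : ∀ a b → 1ℤ ℤ.* a ℤ.+ 0ℤ ℤ.* b ≡ a
    unit = solve-∀

  path-singleton : ∀ v → path 1 v ≗ 𝟎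
  path-singleton v zero    = ≡.trans (cong (ℤ._* v 1) (edge-∣ {1} (1∣ 1))) (*-zeroˡ (v 1))
  path-singleton v (suc n) = ≡.trans
    (cong₂ (λ e e′ → e ℤ.* v n ℤ.+ e′ ℤ.* v (2 + n)) (edge-∣ (1∣ suc n)) (edge-∣ (1∣ (2 + n))))
    (unit (v n) (v (2 + n)))
    where
    unit : ∀ a b → 0ℤ ℤ.* a ℤ.+ 0ℤ ℤ.* b ≡ 0ℤ
    unit = solve-∀

  module _ (d : ℕ) where
    open Chebyshev (path-linear d)

    -- Along a path, adjacency relates neighbouring coordinates by the Chebyshev recurrence, so
    -- `U n` moves coordinate `n + b` to the left end `b`; the bound `n < d` keeps it on the same
    -- path.
    U-left-end : ∀ {b} → d ∣ b → ∀ n → n < d → ∀ v → U n v b ≡ v (n + b)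
    U-left-end d∣b zero          lt v = refl
    U-left-end d∣b (suc zero)    lt v = path-left-end d∣b lt v
    U-left-end {b} d∣b (suc (suc n)) lt v = ≡.trans
      (cong₂ ℤ._-_
        (≡.trans (U-left-end d∣b (suc n) (ℕ.<-trans (ℕ.n<1+n _) lt) (path d v)) (path-inside d∣b lt v))
        (U-left-end d∣b n (ℕ.<-trans (ℕ.n<1+n _) (ℕ.<-trans (ℕ.n<1+n _) lt)) v))
      (cancel (v (n + b)) (v (2 + n + b)))
      where
      cancel : ∀ a b → a ℤ.+ b ℤ.- a ≡ b
      cancel = solve-∀

    -- The index `d` is one step past the last vertex: the edge leaving the right end has weight
    -- zero, so the recurrence leaves two equal terms that cancel. For `d = 1` the operator itself
    -- is zero.
    U-left-end-vanish : ∀ {b} → d ∣ b → ∀ n → suc n ≡ d → ∀ v → U d v b ≡ 0ℤ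
    U-left-end-vanish {b} d∣b zero refl v = path-singleton v b
    U-left-end-vanish {b} d∣b (suc n) refl v = ≡.trans
      (cong₂ ℤ._-_
        (≡.trans (U-left-end d∣b (suc n) ℕ.≤-refl (path d v)) (path-right-end d∣b n refl v))
        (U-left-end d∣b n (ℕ.<-trans (ℕ.n<1+n _) ℕ.≤-refl) v))
      (cancel (v (n + b)))
      where
      cancel : ∀ a → a ℤ.- a ≡ 0ℤ
      cancel = solve-∀

  -- The left end of each path is a cyclic (co)vector, so it is enough that U d vanishes there.
  U-path-vanish : ∀ e v → Chebyshev.U (path-linear (suc e)) (suc e) v ≗ 𝟎
  U-path-vanish e v k = begin
    U d v k                     ≡⟨ cong (U d v) (m≡m%n+[m/n]*n k d) ⟩
    U d v (k % d + k / d * d)   ≡⟨ U-left-end d (n∣m*n (k / d)) (k % d) (m%n<n k d) (U d v) ⟨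
    U (k % d) (U d v) (k / d * d) ≡⟨ U-U-comm (k % d) d v (k / d * d) ⟩
    U d (U (k % d) v) (k / d * d) ≡⟨ U-left-end-vanish d (n∣m*n (k / d)) e refl _ ⟩
    0ℤ ∎
    where
    d : ℕ
    d = suc e
    open Chebyshev (path-linear d)
    open ≡-Reasoning

-- Words in the generators and the universal property.

module Words {c ℓ : Level} (C : CoxeterSystem c ℓ) where
  open CoxeterSystem C
  open Group W hiding (isEquivalence) renaming (refl to ≈-refl; sym to ≈-sym; trans to ≈-trans)
  open GroupProperties W
  open SetoidReasoning setoid

  prod-++ : ∀ is js → prod C (is ++ js) ≈ prod C is ∙ prod C js
  prod-++ []       js = ≈-sym (identityˡ _)
  prod-++ (i ∷ is) js = ≈-trans (∙-congˡ (prod-++ is js)) (≈-sym (assoc _ _ _))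

  prod-[] : ∀ i → prod C [ i ] ≈ gen i
  prod-[] i = identityʳ (gen i)

  gen∙gen≈ε : ∀ i → gen i ∙ gen i ≈ ε
  gen∙gen≈ε i = ≈-trans (≈-sym (identityʳ _)) (rel i i 1 (m-diag i))

  gen⁻¹≈gen : ∀ i → gen i ⁻¹ ≈ gen i
  gen⁻¹≈gen i = ≈-sym (inverseˡ-unique _ _ (gen∙gen≈ε i))

  prod-reverse : ∀ is → prod C (reverse is) ≈ prod C is ⁻¹
  prod-reverse []       = ≈-sym ε⁻¹≈ε
  prod-reverse (i ∷ is) = begin
    prod C (reverse (i ∷ is))      ≡⟨ cong (prod C) (List.unfold-reverse i is) ⟩
    prod C (reverse is ∷ʳ i)       ≈⟨ prod-++ (reverse is) [ i ] ⟩
    prod C (reverse is) ∙ prod C [ i ]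
      ≈⟨ ∙-cong (prod-reverse is) (≈-trans (prod-[] i) (≈-sym (gen⁻¹≈gen i))) ⟩
    prod C is ⁻¹ ∙ gen i ⁻¹        ≈⟨ ⁻¹-anti-homo-∙ (gen i) (prod C is) ⟨
    prod C (i ∷ is) ⁻¹             ∎

  alternating : I → I → ℕ → List I
  alternating i j zero    = []
  alternating i j (suc k) = i ∷ j ∷ alternating i j k

  -- Encodes a group generated by `I` in which the Coxeter relations hold. Inverses are reversals,
  -- since `relator i i 1` makes each letter an involution.
  record IsWordCongruence (_~_ : Rel (List I) ℓ) : Set ℓ where
    field
      isEquivalence : IsEquivalence _~_
      ++-cong       : ∀ {is is′ js js′} → is ~ is′ → js ~ js′ → (is ++ js) ~ (is′ ++ js′)
      relator       : ∀ i j k → m i j ≡ just k → alternating i j k ~ []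

  module _ {_~_ : Rel (List I) ℓ} (~-cong : IsWordCongruence _~_) where
    open IsWordCongruence ~-cong
    open IsEquivalence isEquivalence
      renaming (refl to ~-refl; sym to ~-sym; trans to ~-trans; reflexive to ~-reflexive)

    private
      reverse-inverseˡ : ∀ is → (reverse is ++ is) ~ []
      reverse-inverseˡ []       = ~-refl
      reverse-inverseˡ (i ∷ is) = ~-trans
        (~-reflexive (≡.trans (cong (_++ i ∷ is) (List.unfold-reverse i is))
                              (List.++-assoc (reverse is) [ i ] (i ∷ is))))
        (~-trans (++-cong {reverse is} ~-refl (++-cong (relator i i 1 (m-diag i)) ~-refl))
                 (reverse-inverseˡ is))

      reverse-inverseʳ : ∀ is → (is ++ reverse is) ~ []
      reverse-inverseʳ is = ~-trans
        (~-reflexive (cong (_++ reverse is) (≡.sym (List.reverse-involutive is))))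
        (reverse-inverseˡ (reverse is))

      reverse-cong : ∀ {is js} → is ~ js → reverse is ~ reverse js
      reverse-cong {is} {js} eq =
        ~-trans (~-reflexive (≡.sym (List.++-identityʳ _)))
        (~-trans (++-cong {reverse is} ~-refl (~-sym (reverse-inverseʳ js)))
        (~-trans (~-reflexive (≡.sym (List.++-assoc (reverse is) js _)))
                 (++-cong (~-trans (++-cong {reverse is} ~-refl (~-sym eq)) (reverse-inverseˡ is)) ~-refl)))

      quotient : Group c ℓ
      quotient = record
        { Carrier = Lift c (List I)
        ; _≈_     = λ x y → lower x ~ lower y
        ; _∙_     = λ x y → lift (lower x ++ lower y)
        ; ε       = lift []
        ; _⁻¹     = λ x → lift (reverse (lower x))
        ; isGroup = record
          { isMonoid = record
            { isSemigroup = record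
              { isMagma = record
                { isEquivalence = record { refl = ~-refl ; sym = ~-sym ; trans = ~-trans }
                ; ∙-cong        = ++-cong
                }
              ; assoc = λ x y z → ~-reflexive (List.++-assoc (lower x) (lower y) (lower z))
              }
            ; identity = (λ _ → ~-refl) , (λ x → ~-reflexive (List.++-identityʳ (lower x)))
            }
          ; inverse = (λ x → reverse-inverseˡ (lower x)) , (λ x → reverse-inverseʳ (lower x))
          ; ⁻¹-cong = reverse-cong
          }
        }

      lower-pow : ∀ i j k → lower (pow quotient (lift (i ∷ j ∷ [])) k) ≡ alternating i j k
      lower-pow i j zero    = refl
      lower-pow i j (suc k) = cong (λ is → i ∷ j ∷ is) (lower-pow i j k)

    -- The quotient by `_~_` satisfies the relations, so `universal` gives a homomorphism from `W`
    -- that sends the product of a word to its class. Invariants of words that respect the relators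
    -- thereby descend to `W`.
    prod≈⇒~ : ∀ {is js} → prod C is ≈ prod C js → is ~ js
    prod≈⇒~ {is} {js} eq with universal quotient (λ i → lift [ i ])
      (λ i j k p → ~-trans (~-reflexive (lower-pow i j k)) (relator i j k p))
    ... | φ , φ-hom , φ-gen , _ =
      ~-trans (~-sym (φ-prod is)) (~-trans (⟦⟧-cong eq) (φ-prod js))
      where
      open GroupMorphisms.IsGroupHomomorphism φ-hom
      φ-prod : ∀ ks → lower (φ (prod C ks)) ~ ks
      φ-prod []       = ε-homo
      φ-prod (k ∷ ks) = ~-trans (homo _ _) (++-cong (φ-gen k) (φ-prod ks))

  -- Equality on `I` need not be decidable, but by `m-diag` and `m-off` the entry `m i j` is
  -- `just 1` exactly when `i ≢ j` fails.
  ≢? : ∀ i j → Dec (i ≢ j)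
  ≢? i j = map′ (λ neq eq → neq (≡.trans (cong (m i) (≡.sym eq)) (m-diag i)))
                (λ neq eq → contradiction (m-off i j neq 1 eq) λ { (s≤s ()) })
                (¬? (Maybe.≡-dec ℕ._≟_ (m i j) (just 1)))

-- An integral geometric representation and the distinctness of the generators.

-- Replacing 2cos(π/k) by the adjacency operator of a graph all of whose components
-- are paths on k - 1 vertices gives a geometric representation without real numbers.
module Representation {c ℓ : Level} (C : CoxeterSystem c ℓ) where
  open CoxeterSystem C
  open Group W using (_≈_)
  open Words C
  open LinearAlgebra
  open Linear

  -- The substitute for 2cos(π/k), which is -2 at `k = 1`. At `nothing` there is no relation to
  -- satisfy, so any linear operator would do.
  entry : Maybe ℕ → V → V
  entry (just (suc (suc e))) v = path (suc e) v
  entry (just 1)             v = 𝟎 ⊖ (v ⊕ v)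
  entry (just zero)          v = 𝟎
  entry nothing              v = 𝟎

  𝟎-linear : Linear (λ _ → 𝟎)
  𝟎-linear = record { cong-≗ = λ _ _ → refl ; add = λ _ _ _ → refl }

  entry-linear : ∀ k → Linear (entry k)
  entry-linear (just (suc (suc e))) = path-linear (suc e)
  entry-linear (just 1)             = record
    { cong-≗ = λ eq n → cong (λ a → 0ℤ ℤ.- (a ℤ.+ a)) (eq n)
    ; add    = λ v w n → distrib (v n) (w n)
    }
    where
    distrib : ∀ a b → 0ℤ ℤ.- (a ℤ.+ b ℤ.+ (a ℤ.+ b)) ≡ (0ℤ ℤ.- (a ℤ.+ a)) ℤ.+ (0ℤ ℤ.- (b ℤ.+ b))
    distrib = solve-∀
  entry-linear (just zero)          = 𝟎-linear
  entry-linear nothing              = 𝟎-linear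

  infix 4 _≐_
  _≐_ : Rel (I → V) _
  x ≐ y = ∀ l → x l ≗ y l

  -- `x l` is the value of a `V`-valued functional at the simple root `l`, and `act x i` is its
  -- composite with the simple reflection `i`. Working with functionals avoids sums over `I`.
  act : (I → V) → I → (I → V)
  act x i l = x l ⊕ entry (m l i) (x i)

  acts : (I → V) → List I → (I → V)
  acts x []       = x
  acts x (i ∷ is) = acts (act x i) is

  acts-cong : ∀ {x y} → x ≐ y → ∀ is → acts x is ≐ acts y is
  acts-cong eq []       = eq
  acts-cong eq (i ∷ is) = acts-cong
    (λ l n → cong₂ ℤ._+_ (eq l n) (cong-≗ (entry-linear (m l i)) (eq i) n)) is

  acts-++ : ∀ x is js → acts x (is ++ js) ≡ acts (acts x is) js
  acts-++ x []       js = refl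
  acts-++ x (i ∷ is) js = acts-++ (act x i) is js

  act-self : ∀ x i → act x i i ≗ 𝟎 ⊖ x i
  act-self x i n = ≡.trans (cong (λ k → x i n ℤ.+ entry k (x i) n) (m-diag i)) (negate (x i n))
    where
    negate : ∀ a → a ℤ.+ (0ℤ ℤ.- (a ℤ.+ a)) ≡ 0ℤ ℤ.- a
    negate = solve-∀

  act-other : ∀ {a} i j → m i j ≡ a → ∀ x → act x i j ≗ x j ⊕ entry a (x i)
  act-other i j eq x n = cong (λ k → x j n ℤ.+ entry k (x i) n) (≡.trans (m-sym j i) eq)

  -- From `m i j ≡ just 1` the equality of `i` and `j` follows only up to double negation. This is
  -- enough for equations between matrix entries or integers, which are decidable and hence stable.
  act-act-same : ∀ i j → m i j ≡ just 1 → ∀ x → act (act x i) j ≐ x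
  act-act-same i j eq x l n = ≡.trans
    (cong₂ (λ a b → x l n ℤ.+ a ℤ.+ b)
      (≡.trans (cong (λ k → entry k (x i) n) rows) (cong-≗ lin columns n))
      (≡.trans (cong-≗ lin flipped n) (sub lin 𝟎 (x j) n)))
    (≡.trans (cong (λ z → x l n ℤ.+ entry (m l j) (x j) n ℤ.+ (z ℤ.- entry (m l j) (x j) n)) (vanish lin n))
             (cancel (x l n) _))
    where
    lin : Linear (entry (m l j))
    lin = entry-linear (m l j)
    same : ¬ i ≢ j
    same neq = contradiction (m-off i j neq 1 eq) λ { (s≤s ()) }
    rows : m l i ≡ m l j
    rows = decidable-stable (Maybe.≡-dec ℕ._≟_ _ _) λ neq → same λ { refl → neq refl }
    columns : x i ≗ x j
    columns k = decidable-stable (x i k ℤ.≟ x j k) λ neq → same λ { refl → neq refl }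
    flipped : act x i j ≗ 𝟎 ⊖ x j
    flipped k = ≡.trans (act-other i j eq x k)
      (≡.trans (cong (λ a → x j k ℤ.+ (0ℤ ℤ.- (a ℤ.+ a))) (columns k)) (negate (x j k)))
      where
      negate : ∀ a → a ℤ.+ (0ℤ ℤ.- (a ℤ.+ a)) ≡ 0ℤ ℤ.- a
      negate = solve-∀
    cancel : ∀ a b → a ℤ.+ b ℤ.+ (0ℤ ℤ.- b) ≡ a
    cancel = solve-∀

  module _ (e : ℕ) where
    open Chebyshev (path-linear (suc e))

    private
      p : V → V
      p = path (suc e)

    sequence : V → V → ℕ → V
    sequence v w zero          = v
    sequence v w (suc zero)    = w
    sequence v w (suc (suc n)) = p (sequence v w (suc n)) ⊖ sequence v w n

    sequence-recurrent : ∀ v w → Recurrent (sequence v w)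
    sequence-recurrent v w n k = unsub (p (sequence v w (suc n)) k) (sequence v w n k)
      where
      unsub : ∀ a b → a ≡ a ℤ.- b ℤ.+ b
      unsub = solve-∀

    sequence-cong : ∀ {v v′ w w′} → v ≗ v′ → w ≗ w′ → ∀ n → sequence v w n ≗ sequence v′ w′ n
    sequence-cong eq eq′ zero          = eq
    sequence-cong eq eq′ (suc zero)    = eq′
    sequence-cong eq eq′ (suc (suc n)) k = cong₂ ℤ._-_
      (cong-≗ (path-linear (suc e)) (sequence-cong eq eq′ (suc n)) k) (sequence-cong eq eq′ n k)

    sequence-shift : ∀ v w n → sequence (sequence v w 2) (sequence v w 3) n ≗ sequence v w (2 + n)
    sequence-shift v w zero          k = refl
    sequence-shift v w (suc zero)    k = refl
    sequence-shift v w (suc (suc n)) k = cong₂ ℤ._-_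
      (cong-≗ (path-linear (suc e)) (sequence-shift v w (suc n)) k) (sequence-shift v w n k)

    module _ (i j : I) (m≡ : m i j ≡ just (2 + e)) where

      -- orbit x n is the coordinate that the n-th letter of i j i j … reads off.
      orbit : (I → V) → ℕ → V
      orbit x = sequence (x i) (x j ⊕ p (x i))

      -- A recurrent sequence is determined by its first two terms, so only these are compared after
      -- acting by `i` and `j`.
      orbit-step : ∀ x n → orbit (act (act x i) j) n ≗ orbit x (2 + n)
      orbit-step x n k = ≡.trans (sequence-cong first second n k) (sequence-shift _ _ n k)
        where
        y : I → V
        y = act x i
        read : y j ≗ orbit x 1
        read = act-other i j m≡ x
        first : act y j i ≗ orbit x 2
        first k = ≡.trans (act-other j i (≡.trans (m-sym j i) m≡) y k)
          (≡.trans (cong₂ ℤ._+_ (act-self x i k) (cong-≗ (path-linear (suc e)) read k))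
                   (swap (x i k) _))
          where
          swap : ∀ a b → 0ℤ ℤ.- a ℤ.+ b ≡ b ℤ.- a
          swap = solve-∀
        second : act y j j ⊕ p (act y j i) ≗ orbit x 3
        second k = ≡.trans
          (cong₂ ℤ._+_ (≡.trans (act-self y j k) (cong (λ a → 0ℤ ℤ.- a) (read k)))
                       (cong-≗ (path-linear (suc e)) first k))
          (swap (orbit x 1 k) _)
          where
          swap : ∀ a b → 0ℤ ℤ.- a ℤ.+ b ≡ b ℤ.- a
          swap = solve-∀

      -- Each letter adds to coordinate `l` an operator applied to the coordinate that it reads. The
      -- letters `i` read the terms of `orbit x` of even index, the letters `j` those of odd index.
      acts-alternating : ∀ k x l → acts x (alternating i j k) l
        ≗ x l ⊕ entry (m l i) (evens (orbit x) k) ⊕ entry (m l j) (evens (orbit x ∘ suc) k)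
      acts-alternating zero    x l n = ≡.sym (≡.trans
        (cong₂ (λ a b → x l n ℤ.+ a ℤ.+ b) (vanish (entry-linear (m l i)) n)
                                            (vanish (entry-linear (m l j)) n))
        (unit (x l n)))
        where
        unit : ∀ a → a ℤ.+ 0ℤ ℤ.+ 0ℤ ≡ a
        unit = solve-∀
      acts-alternating (suc k) x l n = ≡.trans (acts-alternating k (act (act x i) j) l n)
        (≡.trans
          (cong₂ (λ a b → x l n ℤ.+ f (x i) n ℤ.+ g (act x i j) n ℤ.+ a ℤ.+ b)
            (cong-≗ f-lin (evens-cong (orbit-step x) k) n)
            (cong-≗ g-lin (evens-cong (orbit-step x ∘ suc) k) n))
          (≡.trans
            (cong (λ a → x l n ℤ.+ f (x i) n ℤ.+ a ℤ.+ f rest n ℤ.+ g rest′ n)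
              (cong-≗ g-lin (act-other i j m≡ x) n))
            (≡.trans (rearrange (x l n) (f (x i) n) _ (f rest n) _)
              (≡.sym (cong₂ (λ a b → x l n ℤ.+ a ℤ.+ b) (add f-lin (x i) rest n)
                                                         (add g-lin (orbit x 1) rest′ n))))))
        where
        f g : V → V
        f = entry (m l i)
        g = entry (m l j)
        f-lin : Linear f
        f-lin = entry-linear (m l i)
        g-lin : Linear g
        g-lin = entry-linear (m l j)
        rest rest′ : V
        rest  = evens (orbit x ∘ (2 +_)) k
        rest′ = evens (orbit x ∘ (3 +_)) k
        rearrange : ∀ a b x y z → a ℤ.+ b ℤ.+ x ℤ.+ y ℤ.+ z ≡ a ℤ.+ (b ℤ.+ y) ℤ.+ (x ℤ.+ z)
        rearrange = solve-∀

      -- The sum of `2 + e` alternate terms is `U (1 + e)` applied to a vector, and `U (1 + e)`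
      -- vanishes for paths on `1 + e` vertices.
      acts-relator : ∀ x → acts x (alternating i j (2 + e)) ≐ x
      acts-relator x l n = ≡.trans (acts-alternating (2 + e) x l n) (≡.trans
        (cong₂ (λ a b → x l n ℤ.+ a ℤ.+ b)
          (≡.trans (cong-≗ (entry-linear (m l i)) (evens-vanish (orbit x) (sequence-recurrent _ _)) n)
                   (vanish (entry-linear (m l i)) n))
          (≡.trans (cong-≗ (entry-linear (m l j))
                     (evens-vanish (orbit x ∘ suc) (sequence-recurrent _ _ ∘ suc)) n)
                   (vanish (entry-linear (m l j)) n)))
        (unit (x l n)))
        where
        evens-vanish : ∀ v → Recurrent v → evens v (2 + e) ≗ 𝟎
        evens-vanish v r k = ≡.trans (≡.sym (U-evens (suc e) v r k)) (U-path-vanish e (v (suc e)) k)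
        unit : ∀ a → a ℤ.+ 0ℤ ℤ.+ 0ℤ ≡ a
        unit = solve-∀

  acts-congruence : IsWordCongruence (λ is js → Lift ℓ (∀ x → acts x is ≐ acts x js))
  acts-congruence = record
    { isEquivalence = record
      { refl  = lift λ _ _ _ → refl
      ; sym   = λ eq → lift λ x l n → ≡.sym (lower eq x l n)
      ; trans = λ eq eq′ → lift λ x l n → ≡.trans (lower eq x l n) (lower eq′ x l n)
      }
    ; ++-cong = λ {is} {is′} {js} {js′} eq eq′ → lift λ x l n → ≡.trans
        (cong (λ y → y l n) (acts-++ x is js))
        (≡.trans (acts-cong (lower eq x) js l n)
          (≡.trans (lower eq′ (acts x is′) l n) (cong (λ y → y l n) (≡.sym (acts-++ x is′ js′)))))
    ; relator = λ i j k eq → lift (relator i j k eq)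
    }
    where
    relator : ∀ i j k → m i j ≡ just k → ∀ x → acts x (alternating i j k) ≐ x
    relator i j zero          eq x l n = refl
    relator i j (suc zero)    eq x l n = act-act-same i j eq x l n
    relator i j (suc (suc e)) eq x l n = acts-relator e i j eq x l n

  -- On the indicator of `j`, the letter `i` keeps the `j`-coordinate at 1, while the letter `j`
  -- turns it into -1. The double negation reflects that equality on `I` need not be decidable.
  gen-injective : ∀ {i j} → gen i ≈ gen j → ¬ i ≢ j
  gen-injective {i} {j} gi≈gj i≢j = distinct
    (lower (prod≈⇒~ acts-congruence {[ i ]} {[ j ]} eq) x j 0)
    where
    open Group W using () renaming (sym to ≈-sym; trans to ≈-trans)
    eq : prod C [ i ] ≈ prod C [ j ]
    eq = ≈-trans (prod-[] i) (≈-trans gi≈gj (≈-sym (prod-[] j)))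
    x : I → V
    x l _ = if does (≢? l j) then 0ℤ else 1ℤ
    xi≗0 : x i ≗ 𝟎
    xi≗0 _ = cong (if_then 0ℤ else 1ℤ) (dec-true (≢? i j) i≢j)
    xj≡1 : x j 0 ≡ 1ℤ
    xj≡1 = cong (if_then 0ℤ else 1ℤ) (dec-false (≢? j j) (λ neq → neq refl))
    distinct : act x i j 0 ≢ act x j j 0
    distinct eq = contradiction
      (≡.trans (≡.sym (cong₂ ℤ._+_ xj≡1 entry-i))
        (≡.trans eq (≡.trans (act-self x j 0) (cong (λ a → 0ℤ ℤ.- a) xj≡1)))) λ ()
      where
      entry-i : entry (m j i) (x i) 0 ≡ 0ℤ
      entry-i = ≡.trans (cong-≗ (entry-linear (m j i)) xi≗0 0) (vanish (entry-linear (m j i)) 0)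

-- The reflection cocycle and strong exchange.

module Length {c ℓ : Level} (C : CoxeterSystem c ℓ)
  (len : Group.Carrier (CoxeterSystem.W C) → ℕ) (isLen : IsLengthFunction C len) where
  open CoxeterSystem C
  open Group W hiding (isEquivalence) renaming (refl to ≈-refl; sym to ≈-sym; trans to ≈-trans)
  open GroupProperties W
  open Words C
  open SetoidReasoning setoid

  len-minimal : ∀ {w} is → prod C is ≈ w → len w ≤ length is
  len-minimal {w} is = proj₂ (isLen w) is

  word : Carrier → List I
  word w = proj₁ (proj₁ (isLen w))

  prod-word : ∀ w → prod C (word w) ≈ w
  prod-word w = proj₁ (proj₂ (proj₁ (isLen w)))

  length-word : ∀ w → length (word w) ≡ len w
  length-word w = proj₂ (proj₂ (proj₁ (isLen w)))

  len-cong : ∀ {w x} → w ≈ x → len w ≡ len x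
  len-cong w≈x = ℕ.≤-antisym (len-≤ w≈x) (len-≤ (≈-sym w≈x))
    where
    len-≤ : ∀ {w x} → w ≈ x → len w ≤ len x
    len-≤ {w} {x} eq = subst (len w ≤_) (length-word x)
      (len-minimal (word x) (≈-trans (prod-word x) (≈-sym eq)))

  len-∙ : ∀ x y → len (x ∙ y) ≤ len x + len y
  len-∙ x y = subst (len (x ∙ y) ≤_)
    (≡.trans (List.length-++ (word x)) (cong₂ _+_ (length-word x) (length-word y)))
    (len-minimal (word x ++ word y)
      (≈-trans (prod-++ (word x) (word y)) (∙-cong (prod-word x) (prod-word y))))

  len≡0⇒≈ε : ∀ w → len w ≡ 0 → w ≈ ε
  len≡0⇒≈ε w eq with word w | prod-word w | length-word w
  ... | []    | p | _ = ≈-sym p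
  ... | _ ∷ _ | _ | q = contradiction (≡.trans q eq) λ ()

  abstract
    -- The length function decides equality in `W`, because only the identity has length zero.
    _≟_ : ∀ x y → Dec (x ≈ y)
    x ≟ y = map′ (x∙y⁻¹≈ε⇒x≈y x y ∘ len≡0⇒≈ε _)
                 (λ eq → ℕ.n≤0⇒n≡0 (len-minimal [] (≈-sym (x≈y⇒x∙y⁻¹≈ε eq))))
                 (len (x ∙ y ⁻¹) ℕ.≟ 0)

  ≟-cong : ∀ {x y x′ y′} → (x ≈ y → x′ ≈ y′) → (x′ ≈ y′ → x ≈ y) → does (x ≟ y) ≡ does (x′ ≟ y′)
  ≟-cong {x} {y} {x′} {y′} f g = does-⇔ (mk⇔ f g) (x ≟ y) (x′ ≟ y′)

  infixl 8 _^_
  _^_ : Carrier → Carrier → Carrier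
  t ^ x = x ⁻¹ ∙ (t ∙ x)

  ∙-^ : ∀ t x → x ∙ t ^ x ≈ t ∙ x
  ∙-^ t x = \\-leftDividesˡ x (t ∙ x)

  ^-unique : ∀ {t x s} → t ∙ x ≈ x ∙ s → t ^ x ≈ s
  ^-unique {t} {x} {s} eq = ≈-trans (∙-congˡ eq) (\\-leftDividesʳ x s)

  ^-cong : ∀ {s t x y} → s ≈ t → x ≈ y → s ^ x ≈ t ^ y
  ^-cong eq eq′ = ∙-cong (⁻¹-cong eq′) (∙-cong eq eq′)

  ^-ε : ∀ t → t ^ ε ≈ t
  ^-ε t = ^-unique (≈-trans (identityʳ t) (≈-sym (identityˡ t)))

  ^-self : ∀ t → t ^ t ≈ t
  ^-self t = ^-unique ≈-refl

  ^-∙ : ∀ t x y → t ^ (x ∙ y) ≈ (t ^ x) ^ y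
  ^-∙ t x y = ^-unique (begin
    t ∙ (x ∙ y)          ≈⟨ assoc t x y ⟨
    (t ∙ x) ∙ y          ≈⟨ ∙-congʳ (∙-^ t x) ⟨
    (x ∙ t ^ x) ∙ y      ≈⟨ assoc x (t ^ x) y ⟩
    x ∙ (t ^ x ∙ y)      ≈⟨ ∙-congˡ (∙-^ (t ^ x) y) ⟨
    x ∙ (y ∙ (t ^ x) ^ y) ≈⟨ assoc x y _ ⟨
    (x ∙ y) ∙ (t ^ x) ^ y ∎)

  -- The parity of the number of occurrences of t among the elements
  -- s₁⋯sₖ₋₁ sₖ sₖ₋₁⋯s₁ attached to the word s₁⋯sₙ.
  parity : List I → Carrier → Bool
  parity []       t = false
  parity (i ∷ is) t = does (t ≟ gen i) xor parity is (t ^ gen i)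

  parity-congʳ : ∀ is {t t′} → t ≈ t′ → parity is t ≡ parity is t′
  parity-congʳ []       eq = refl
  parity-congʳ (i ∷ is) eq = cong₂ _xor_
    (≟-cong (≈-trans (≈-sym eq)) (≈-trans eq)) (parity-congʳ is (^-cong eq ≈-refl))

  parity-++ : ∀ is js t → parity (is ++ js) t ≡ parity is t xor parity js (t ^ prod C is)
  parity-++ []       js t = parity-congʳ js (≈-sym (^-ε t))
  parity-++ (i ∷ is) js t = ≡.trans
    (cong (does (t ≟ gen i) xor_)
      (≡.trans (parity-++ is js (t ^ gen i))
               (cong (parity is (t ^ gen i) xor_) (parity-congʳ js (≈-sym (^-∙ t (gen i) (prod C is)))))))
    (≡.sym (Bool.xor-assoc (does (t ≟ gen i)) _ _))

  xors : (ℕ → Bool) → ℕ → Bool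
  xors f zero    = false
  xors f (suc n) = f 0 xor xors (f ∘ suc) n

  xors-cong : ∀ {f g} → f ≗ g → xors f ≗ xors g
  xors-cong eq zero    = refl
  xors-cong eq (suc n) = cong₂ _xor_ (eq 0) (xors-cong (eq ∘ suc) n)

  xors-+ : ∀ f k n → xors f (k + n) ≡ xors f k xor xors (f ∘ (k +_)) n
  xors-+ f zero    n = refl
  xors-+ f (suc k) n = ≡.trans (cong (f 0 xor_) (xors-+ (f ∘ suc) k n)) (≡.sym (Bool.xor-assoc (f 0) _ _))

  xors-periodic : ∀ f k → f ∘ (k +_) ≗ f → xors f (k * 2) ≡ false
  xors-periodic f k periodic = ≡.trans (cong (xors f) k*2≡k+k)
    (≡.trans (xors-+ f k k)
      (≡.trans (cong (xors f k xor_) (xors-cong periodic k)) (Bool.xor-same (xors f k))))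
    where
    k*2≡k+k : k * 2 ≡ k + k
    k*2≡k+k = ≡.trans (ℕ.*-comm k 2) (cong (k +_) (ℕ.+-identityʳ k))

  module _ (i j : I) where
    private
      ρ : Carrier
      ρ = gen i ∙ gen j

      ρ^ : ℕ → Carrier
      ρ^ = pow W ρ

    pow-comm : ∀ a → ρ^ a ∙ ρ ≈ ρ ∙ ρ^ a
    pow-comm zero    = ≈-trans (identityˡ ρ) (≈-sym (identityʳ ρ))
    pow-comm (suc a) = ≈-trans (assoc ρ _ ρ) (∙-congˡ (pow-comm a))

    pow-+ : ∀ k a → ρ^ (k + a) ≈ ρ^ k ∙ ρ^ a
    pow-+ zero    a = ≈-sym (identityˡ _)
    pow-+ (suc k) a = ≈-trans (∙-congˡ (pow-+ k a)) (≈-sym (assoc ρ _ _))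

    prod-alternating : ∀ k → prod C (alternating i j k) ≈ ρ^ k
    prod-alternating zero    = ≈-refl
    prod-alternating (suc k) =
      ≈-trans (≈-sym (assoc (gen i) (gen j) _)) (∙-congˡ (prod-alternating k))

    -- The elements attached to the letters of `alternating i j k` are `ρ^ a ∙ gen i` for
    -- `a < k * 2`.
    isReflectionAt : Carrier → ℕ → Bool
    isReflectionAt t a = does (t ≟ (ρ^ a ∙ gen i))

    at-zero : ∀ t → does (t ≟ gen i) ≡ isReflectionAt t 0
    at-zero t = ≟-cong (λ eq → ≈-trans eq (≈-sym (identityˡ _))) (λ eq → ≈-trans eq (identityˡ _))

    at-one : ∀ t → does ((t ^ gen i) ≟ gen j) ≡ isReflectionAt t 1
    at-one t = ≟-cong forwards backwards
      where
      forwards : t ^ gen i ≈ gen j → t ≈ ρ^ 1 ∙ gen i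
      forwards eq = ∙-cancelʳ (gen i) t _ (begin
        t ∙ gen i                    ≈⟨ ∙-^ t (gen i) ⟨
        gen i ∙ t ^ gen i            ≈⟨ ∙-congˡ eq ⟩
        ρ                            ≈⟨ identityʳ ρ ⟨
        ρ^ 1                         ≈⟨ identityʳ _ ⟨
        ρ^ 1 ∙ ε                     ≈⟨ ∙-congˡ (gen∙gen≈ε i) ⟨
        ρ^ 1 ∙ (gen i ∙ gen i)       ≈⟨ assoc _ _ _ ⟨
        (ρ^ 1 ∙ gen i) ∙ gen i       ∎)
      backwards : t ≈ ρ^ 1 ∙ gen i → t ^ gen i ≈ gen j
      backwards eq = ^-unique (begin
        t ∙ gen i                    ≈⟨ ∙-congʳ eq ⟩
        (ρ^ 1 ∙ gen i) ∙ gen i       ≈⟨ assoc _ _ _ ⟩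
        ρ^ 1 ∙ (gen i ∙ gen i)       ≈⟨ ∙-congˡ (gen∙gen≈ε i) ⟩
        ρ^ 1 ∙ ε                     ≈⟨ identityʳ _ ⟩
        ρ^ 1                         ≈⟨ identityʳ ρ ⟩
        ρ                            ∎)

    -- Conjugation by `gen i` inverts `ρ`, so conjugation by `ρ` changes the exponent of
    -- `ρ^ a ∙ gen i` by two.
    at-shift : ∀ t a → isReflectionAt ((t ^ gen i) ^ gen j) a ≡ isReflectionAt t (2 + a)
    at-shift t a = ≟-cong forwards backwards
      where
      gen∙ρ : gen i ∙ ρ ≈ gen j
      gen∙ρ = ≈-trans (≈-sym (assoc _ _ _)) (≈-trans (∙-congʳ (gen∙gen≈ε i)) (identityˡ _))
      key : (ρ^ (2 + a) ∙ gen i) ∙ ρ ≈ ρ ∙ (ρ^ a ∙ gen i)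
      key = begin
        (ρ^ (2 + a) ∙ gen i) ∙ ρ     ≈⟨ assoc _ _ _ ⟩
        ρ^ (2 + a) ∙ (gen i ∙ ρ)     ≈⟨ ∙-congˡ gen∙ρ ⟩
        (ρ ∙ (ρ ∙ ρ^ a)) ∙ gen j     ≈⟨ assoc _ _ _ ⟩
        ρ ∙ ((ρ ∙ ρ^ a) ∙ gen j)     ≈⟨ ∙-congˡ (∙-congʳ (pow-comm a)) ⟨
        ρ ∙ ((ρ^ a ∙ ρ) ∙ gen j)     ≈⟨ ∙-congˡ (assoc _ _ _) ⟩
        ρ ∙ (ρ^ a ∙ (ρ ∙ gen j))     ≈⟨ ∙-congˡ (∙-congˡ (assoc _ _ _)) ⟩
        ρ ∙ (ρ^ a ∙ (gen i ∙ (gen j ∙ gen j)))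
          ≈⟨ ∙-congˡ (∙-congˡ (≈-trans (∙-congˡ (gen∙gen≈ε j)) (identityʳ _))) ⟩
        ρ ∙ (ρ^ a ∙ gen i)           ∎
      forwards : (t ^ gen i) ^ gen j ≈ ρ^ a ∙ gen i → t ≈ ρ^ (2 + a) ∙ gen i
      forwards eq = ∙-cancelʳ ρ t _ (begin
        t ∙ ρ                        ≈⟨ ∙-^ t ρ ⟨
        ρ ∙ t ^ ρ                    ≈⟨ ∙-congˡ (≈-trans (^-∙ t (gen i) (gen j)) eq) ⟩
        ρ ∙ (ρ^ a ∙ gen i)           ≈⟨ key ⟨
        (ρ^ (2 + a) ∙ gen i) ∙ ρ     ∎)
      backwards : t ≈ ρ^ (2 + a) ∙ gen i → (t ^ gen i) ^ gen j ≈ ρ^ a ∙ gen i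
      backwards eq = ≈-trans (≈-sym (^-∙ t (gen i) (gen j)))
        (^-unique (≈-trans (∙-congʳ eq) key))

    parity-alternating : ∀ k t → parity (alternating i j k) t ≡ xors (isReflectionAt t) (k * 2)
    parity-alternating zero    t = refl
    parity-alternating (suc k) t = cong₂ _xor_ (at-zero t) (cong₂ _xor_ (at-one t)
      (≡.trans (parity-alternating k _) (xors-cong (at-shift t) (k * 2))))

    -- As `ρ^ k` is the identity, the `k * 2` attached elements run twice through the same `k`
    -- elements, and every count is even.
    parity-relator : ∀ k → m i j ≡ just k → ∀ t → parity (alternating i j k) t ≡ false
    parity-relator k eq t = ≡.trans (parity-alternating k t)
      (xors-periodic (isReflectionAt t) k λ a →
        ≟-cong (λ p → ≈-trans p (∙-congʳ (ρ^k+a a))) (λ p → ≈-trans p (∙-congʳ (≈-sym (ρ^k+a a)))))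
      where
      ρ^k+a : ∀ a → ρ^ (k + a) ≈ ρ^ a
      ρ^k+a a = ≈-trans (pow-+ k a) (≈-trans (∙-congʳ (rel i j k eq)) (identityˡ _))

  -- Equality of products is part of the relation because in a concatenation the test element of the
  -- second word is conjugated by the product of the first. Test elements are given by words to keep
  -- the relation at level `ℓ`.
  parity-congruence : IsWordCongruence
    (λ is js → prod C is ≈ prod C js × (∀ ts → parity is (prod C ts) ≡ parity js (prod C ts)))
  parity-congruence = record
    { isEquivalence = record
      { refl  = ≈-refl , λ _ → refl
      ; sym   = λ (p , q) → ≈-sym p , λ ts → ≡.sym (q ts)
      ; trans = λ (p , q) (p′ , q′) → ≈-trans p p′ , λ ts → ≡.trans (q ts) (q′ ts)
      }
    ; ++-cong = λ {is} {is′} {js} {js′} (p , q) (p′ , q′) →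
        ≈-trans (prod-++ is js) (≈-trans (∙-cong p p′) (≈-sym (prod-++ is′ js′))) ,
        λ ts → ≡.trans (parity-++ is js (prod C ts))
          (≡.trans (cong₂ _xor_ (q ts) (≡.trans (congᵗ {js} {js′} q′ (prod C ts ^ prod C is))
                                                 (parity-congʳ js′ (^-cong ≈-refl p))))
            (≡.sym (parity-++ is′ js′ (prod C ts))))
    ; relator = λ i j k eq → ≈-trans (prod-alternating i j k) (rel i j k eq) ,
                             λ ts → parity-relator i j k eq (prod C ts)
    }
    where
    congᵗ : ∀ {js js′} → (∀ ts → parity js (prod C ts) ≡ parity js′ (prod C ts)) →
            ∀ t → parity js t ≡ parity js′ t
    congᵗ {js} {js′} q t with generated t
    ... | ts , eq = ≡.trans (parity-congʳ js (≈-sym eq)) (≡.trans (q ts) (parity-congʳ js′ eq))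

  parity-cong : ∀ is js {t t′} → prod C is ≈ prod C js → t ≈ t′ → parity is t ≡ parity js t′
  parity-cong is js {t} {t′} eq t≈t′ with generated t
  ... | ts , p = ≡.trans (parity-congʳ is (≈-sym p))
    (≡.trans (proj₂ (prod≈⇒~ parity-congruence {is} {js} eq) ts) (parity-congʳ js (≈-trans p t≈t′)))

  N : Carrier → Carrier → Bool
  N w t = parity (word w) t

  N-cong : ∀ {w x t t′} → w ≈ x → t ≈ t′ → N w t ≡ N x t′
  N-cong {w} {x} eq = parity-cong (word w) (word x) (≈-trans (prod-word w) (≈-trans eq (≈-sym (prod-word x))))

  N-prod : ∀ is {w} t → prod C is ≈ w → N w t ≡ parity is t
  N-prod is {w} t eq = parity-cong (word w) is (≈-trans (prod-word w) (≈-sym eq)) ≈-refl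

  N-∙ : ∀ x y t → N (x ∙ y) t ≡ N x t xor N y (t ^ x)
  N-∙ x y t = ≡.trans (N-prod (word x ++ word y) t
      (≈-trans (prod-++ (word x) (word y)) (∙-cong (prod-word x) (prod-word y))))
    (≡.trans (parity-++ (word x) (word y) t)
      (cong (N x t xor_) (parity-congʳ (word y) (^-cong ≈-refl (prod-word x)))))

  N-ε : ∀ t → N ε t ≡ false
  N-ε t = N-prod [] t ≈-refl

  N-gen-gen : ∀ i → N (gen i) (gen i) ≡ true
  N-gen-gen i = ≡.trans (N-prod [ i ] (gen i) (prod-[] i))
    (cong (_xor false) (dec-true (gen i ≟ gen i) ≈-refl))

  gen-isReflection : ∀ i → IsReflection C (gen i)
  gen-isReflection i = ε , i , (begin
    gen i                ≈⟨ identityˡ (gen i) ⟨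
    ε ∙ gen i            ≈⟨ identityʳ _ ⟨
    (ε ∙ gen i) ∙ ε      ≈⟨ ∙-congˡ ε⁻¹≈ε ⟨
    (ε ∙ gen i) ∙ ε ⁻¹   ∎)

  reflection-^ : ∀ {t w i} → t ≈ (w ∙ gen i) ∙ w ⁻¹ → t ^ w ≈ gen i
  reflection-^ {t} {w} {i} eq = ^-unique (begin
    t ∙ w                        ≈⟨ ∙-congʳ eq ⟩
    ((w ∙ gen i) ∙ w ⁻¹) ∙ w     ≈⟨ //-rightDividesˡ w (w ∙ gen i) ⟩
    w ∙ gen i                    ∎)

  ∙gen-isReflection : ∀ w i → IsReflection C ((w ∙ gen i) ∙ w ⁻¹)
  ∙gen-isReflection w i = w , i , ≈-refl

  -- Along `w`, `gen i`, `w ⁻¹` the middle letter contributes once, and the contributions of `w` and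
  -- `w ⁻¹` cancel since `N (w ∙ w ⁻¹) t` is even.
  N-self : ∀ {t} → IsReflection C t → N t t ≡ true
  N-self {t} (w , i , eq) = ≡.trans (N-cong eq ≈-refl)
    (≡.trans (N-∙ (w ∙ gen i) (w ⁻¹) t)
      (≡.trans (cong₂ _xor_
                 (≡.trans (N-∙ w (gen i) t)
                   (cong (N w t xor_) (≡.trans (N-cong ≈-refl t^w) (N-gen-gen i))))
                 (N-cong ≈-refl (≈-trans (^-∙ t w (gen i)) (≈-trans (^-cong t^w ≈-refl) (^-self (gen i))))))
        (odd (N w t) (N (w ⁻¹) (gen i)) cancels)))
    where
    t^w : t ^ w ≈ gen i
    t^w = reflection-^ eq
    cancels : N w t xor N (w ⁻¹) (gen i) ≡ false
    cancels = ≡.trans (cong (N w t xor_) (N-cong ≈-refl (≈-sym t^w)))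
      (≡.trans (≡.sym (N-∙ w (w ⁻¹) t)) (≡.trans (N-cong (inverseʳ w) ≈-refl) (N-ε t)))
    odd : ∀ a b → a xor b ≡ false → (a xor true) xor b ≡ true
    odd true  true  _ = refl
    odd false false _ = refl
    odd true  false ()
    odd false true  ()

  reflection² : ∀ {t} → IsReflection C t → t ∙ t ≈ ε
  reflection² {t} (w , i , eq) = ∙-cancelʳ w (t ∙ t) ε (begin
    (t ∙ t) ∙ w              ≈⟨ assoc t t w ⟩
    t ∙ (t ∙ w)              ≈⟨ ∙-congˡ tw ⟩
    t ∙ (w ∙ gen i)          ≈⟨ assoc t w (gen i) ⟨
    (t ∙ w) ∙ gen i          ≈⟨ ∙-congʳ tw ⟩
    (w ∙ gen i) ∙ gen i      ≈⟨ assoc w (gen i) (gen i) ⟩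
    w ∙ (gen i ∙ gen i)      ≈⟨ ∙-congˡ (gen∙gen≈ε i) ⟩
    w ∙ ε                    ≈⟨ identityʳ w ⟩
    w                        ≈⟨ identityˡ w ⟨
    ε ∙ w                    ∎)
    where
    tw : t ∙ w ≈ w ∙ gen i
    tw = ≈-trans (≈-sym (∙-^ t w)) (∙-congˡ (reflection-^ eq))

  -- Odd parity means that `t` is attached to some letter, and omitting the first such letter
  -- multiplies the product by `t` on the left. Keeping `js ⊆ is` controls which generators occur.
  strong-exchange : ∀ is t → parity is t ≡ true →
    ∃[ js ] js ⊆ is × suc (length js) ≡ length is × prod C js ≈ t ∙ prod C is
  strong-exchange []       t ()
  strong-exchange (i ∷ is) t p with t ≟ gen i
  ... | yes t≈i = is , i omit ⊆-refl , refl , (begin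
    prod C is                      ≈⟨ identityˡ _ ⟨
    ε ∙ prod C is                  ≈⟨ ∙-congʳ (≈-trans (∙-congʳ t≈i) (gen∙gen≈ε i)) ⟨
    (t ∙ gen i) ∙ prod C is        ≈⟨ assoc _ _ _ ⟩
    t ∙ prod C (i ∷ is)            ∎)
  ... | no _ with strong-exchange is (t ^ gen i) p
  ... | js , js⊆is , eq , q = i ∷ js , refl ∷ js⊆is , cong suc eq , (begin
    gen i ∙ prod C js                     ≈⟨ ∙-congˡ q ⟩
    gen i ∙ (t ^ gen i ∙ prod C is)       ≈⟨ assoc _ _ _ ⟨
    (gen i ∙ t ^ gen i) ∙ prod C is       ≈⟨ ∙-congʳ (∙-^ t (gen i)) ⟩
    (t ∙ gen i) ∙ prod C is               ≈⟨ assoc _ _ _ ⟩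
    t ∙ prod C (i ∷ is)                   ∎)

  N⇒shorter : ∀ {w t} → N w t ≡ true → len (t ∙ w) < len w
  N⇒shorter {w} {t} p with strong-exchange (word w) t p
  ... | js , _ , eq , q = ℕ.≤-trans
    (s≤s (len-minimal js (≈-trans q (∙-congˡ (prod-word w)))))
    (ℕ.≤-reflexive (≡.trans eq (length-word w)))

  -- The cocycle rule and `N-self` make `N (t ∙ w) t` odd, so `t` shortens `t ∙ w` to `w`.
  ¬N⇒longer : ∀ {w t} → IsReflection C t → N w t ≡ false → len w < len (t ∙ w)
  ¬N⇒longer {w} {t} r p = subst (_< len (t ∙ w)) (len-cong t∙t∙w) (N⇒shorter
    (≡.trans (N-∙ t w t) (cong₂ _xor_ (N-self r) (≡.trans (N-cong ≈-refl (^-self t)) p))))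
    where
    t∙t∙w : t ∙ (t ∙ w) ≈ w
    t∙t∙w = ≈-trans (≈-sym (assoc t t w)) (≈-trans (∙-congʳ (reflection² r)) (identityˡ w))

  shorter⇒N : ∀ {w t} → IsReflection C t → len (t ∙ w) < len w → N w t ≡ true
  shorter⇒N {w} {t} r lt with N w t in eq
  ... | true  = refl
  ... | false = contradiction (¬N⇒longer r eq) (ℕ.<-asym lt)

-- Deletion, supports of words, and parabolic decompositions.

module Parabolic {c ℓ : Level} (C : CoxeterSystem c ℓ)
  (len : Group.Carrier (CoxeterSystem.W C) → ℕ) (isLen : IsLengthFunction C len) where
  open CoxeterSystem C
  open Group W hiding (isEquivalence) renaming (refl to ≈-refl; sym to ≈-sym; trans to ≈-trans)
  open GroupProperties W
  open Words C
  open Representation C using (gen-injective)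
  open Length C len isLen

  ⊆-++⁻ : ∀ {A : Set} (as : List A) {bs ks} → ks ⊆ as ++ bs →
          ∃[ as′ ] ∃[ bs′ ] ks ≡ as′ ++ bs′ × as′ ⊆ as × bs′ ⊆ bs
  ⊆-++⁻ []       s = [] , _ , refl , [] , s
  ⊆-++⁻ (a ∷ as) (.a omit s) with ⊆-++⁻ as s
  ... | as′ , bs′ , eq , p , q = as′ , bs′ , eq , a omit p , q
  ⊆-++⁻ (a ∷ as) (refl ∷ s) with ⊆-++⁻ as s
  ... | as′ , bs′ , eq , p , q = a ∷ as′ , bs′ , cong (a ∷_) eq , refl ∷ p , q

  All-reverse : ∀ {p} {P : I → Set p} {is} → All P is → All P (reverse is)
  All-reverse ps = All.tabulate (All.lookup ps ∘ Any.reverse⁻)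

  len-gen : ∀ i → len (gen i) ≡ 1
  len-gen i = ℕ.≤-antisym (len-minimal [ i ] (prod-[] i))
                          (ℕ.≤-trans (s≤s z≤n) (N⇒shorter (N-gen-gen i)))

  len-gen∙ : ∀ i w → len (gen i ∙ w) ≤ suc (len w)
  len-gen∙ i w = subst (λ n → len (gen i ∙ w) ≤ n + len w) (len-gen i) (len-∙ (gen i) w)

  len-∙gen : ∀ w i → len (w ∙ gen i) ≤ suc (len w)
  len-∙gen w i = subst (len (w ∙ gen i) ≤_)
    (≡.trans (cong (len w +_) (len-gen i)) (ℕ.+-comm (len w) 1)) (len-∙ w (gen i))

  ∙gen∙gen : ∀ w i → (w ∙ gen i) ∙ gen i ≈ w
  ∙gen∙gen w i = ≈-trans (assoc _ _ _) (≈-trans (∙-congˡ (gen∙gen≈ε i)) (identityʳ w))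

  gen∙gen∙ : ∀ i w → gen i ∙ (gen i ∙ w) ≈ w
  gen∙gen∙ i w = ≈-trans (≈-sym (assoc _ _ _)) (≈-trans (∙-congʳ (gen∙gen≈ε i)) (identityˡ w))

  Reduced : List I → Set
  Reduced is = length is ≡ len (prod C is)

  word-reduced : ∀ w → Reduced (word w)
  word-reduced w = ≡.trans (length-word w) (len-cong (≈-sym (prod-word w)))

  reduced-tail : ∀ i is → Reduced (i ∷ is) → Reduced is
  reduced-tail i is red = ℕ.≤-antisym
    (s≤s⁻¹ (ℕ.≤-trans (ℕ.≤-reflexive red) (len-gen∙ i (prod C is))))
    (len-minimal is ≈-refl)

  -- Letters are added on the left. If `gen i` fails to lengthen the reduced word `js`, strong
  -- exchange drops `i` together with one letter of `js`.
  deletion : ∀ is → ∃[ js ] js ⊆ is × prod C js ≈ prod C is × Reduced js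
  deletion [] = [] , [] , ≈-refl , ≡.sym (ℕ.n≤0⇒n≡0 (len-minimal [] ≈-refl))
  deletion (i ∷ is) with deletion is
  ... | js , js⊆is , eq , red with parity js (gen i) in par
  ... | false = i ∷ js , refl ∷ js⊆is , ∙-congˡ eq , ℕ.≤-antisym
    (ℕ.≤-trans (s≤s (ℕ.≤-reflexive red))
      (¬N⇒longer (gen-isReflection i) (≡.trans (N-prod js (gen i) ≈-refl) par)))
    (len-minimal (i ∷ js) ≈-refl)
  ... | true with strong-exchange js (gen i) par
  ... | ks , ks⊆js , length-ks , eq′ =
    ks , i omit ⊆-trans ks⊆js js⊆is , ≈-trans eq′ (∙-congˡ eq) , ℕ.≤-antisym
      (s≤s⁻¹ (ℕ.≤-trans (ℕ.≤-reflexive (≡.trans length-ks (≡.trans red (len-cong js≈))))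
                          (len-gen∙ i (prod C ks))))
      (len-minimal ks ≈-refl)
    where
    js≈ : prod C js ≈ gen i ∙ prod C ks
    js≈ = ≈-trans (≈-sym (gen∙gen∙ i _)) (∙-congˡ (≈-sym eq′))

  module _ {p} {J : I → Set p} (J-resp : ∀ {i j} → gen i ≈ gen j → J i → J j) where

    -- A reduced subword for `gen i` is a single letter naming the same generator as `i`, though
    -- perhaps not identical to it; `J-resp` bridges the difference.
    gen-support : ∀ {i} is → All J is → prod C is ≈ gen i → J i
    gen-support {i} is all eq with deletion is
    ... | js , js⊆is , eq′ , red =
      singleton js (All-resp-⊆ js⊆is all) (≈-trans eq′ eq)
        (≡.trans red (≡.trans (len-cong (≈-trans eq′ eq)) (len-gen i)))
      where
      singleton : ∀ js → All J js → prod C js ≈ gen i → length js ≡ 1 → J i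
      singleton (j ∷ []) (Jj ∷ []) eq refl = J-resp (≈-trans (≈-sym (prod-[] j)) eq) Jj

    -- The first letter `i` of `ws` is a left descent, so exchange shortens `is` to a word `is′` for
    -- the tail of `ws`. Then `is ++ reverse is′` spells `gen i` with letters in `J`.
    support : ∀ ws is → Reduced ws → All J is → prod C ws ≈ prod C is → All J ws
    support []       is red all eq = []
    support (i ∷ ws) is red all eq
      with strong-exchange is (gen i) (≡.trans (≡.sym (N-prod is (gen i) ≈-refl))
             (shorter⇒N (gen-isReflection i) shorter))
      where
      ws≈ : gen i ∙ prod C is ≈ prod C ws
      ws≈ = ≈-trans (∙-congˡ (≈-sym eq)) (gen∙gen∙ i _)
      shorter : len (gen i ∙ prod C is) < len (prod C is)
      shorter = ℕ.≤-reflexive (≡.trans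
        (cong suc (≡.trans (len-cong ws≈) (≡.sym (reduced-tail i ws red))))
        (≡.trans red (len-cong eq)))
    ... | is′ , is′⊆is , _ , eq′ =
      gen-support (is ++ reverse is′) (All.++⁺ all (All-reverse all′)) gen≈
        ∷ support ws is′ (reduced-tail i ws red) all′ (≈-sym is′≈ws)
      where
      open SetoidReasoning setoid
      all′ : All J is′
      all′ = All-resp-⊆ is′⊆is all
      is′≈ws : prod C is′ ≈ prod C ws
      is′≈ws = ≈-trans eq′ (≈-trans (∙-congˡ (≈-sym eq)) (gen∙gen∙ i _))
      gen≈ : prod C (is ++ reverse is′) ≈ gen i
      gen≈ = begin
        prod C (is ++ reverse is′)           ≈⟨ prod-++ is (reverse is′) ⟩
        prod C is ∙ prod C (reverse is′)     ≈⟨ ∙-cong (≈-sym eq) (prod-reverse is′) ⟩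
        prod C (i ∷ ws) ∙ prod C is′ ⁻¹      ≈⟨ ∙-congˡ (⁻¹-cong is′≈ws) ⟩
        (gen i ∙ prod C ws) ∙ prod C ws ⁻¹   ≈⟨ //-rightDividesʳ (prod C ws) (gen i) ⟩
        gen i                                ∎

  -- Reduce the word for `z` formed by a shortest word of `z ∙ prod C qs` and the reverse of `qs`.
  -- The last letter that survives is a right descent of `z`, and it comes from `qs`.
  descent-in-word : ∀ z qs → len (z ∙ prod C qs) < len z → Any (DR C len z) qs
  descent-in-word z qs lt with deletion (as ++ reverse qs)
    where
    as : List I
    as = word (z ∙ prod C qs)
  ... | ks , ks⊆ , eq , red with ⊆-++⁻ (word (z ∙ prod C qs)) ks⊆
  ... | as′ , bs′ , refl , as′⊆ , bs′⊆ = Any.reverse⁻ (Any-resp-⊆ bs′⊆ (last-descent bs′ red ks≈z))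
    where
    open SetoidReasoning setoid
    a : Carrier
    a = z ∙ prod C qs
    ks≈z : prod C (as′ ++ bs′) ≈ z
    ks≈z = begin
      prod C (as′ ++ bs′)                        ≈⟨ eq ⟩
      prod C (word a ++ reverse qs)              ≈⟨ prod-++ (word a) (reverse qs) ⟩
      prod C (word a) ∙ prod C (reverse qs)      ≈⟨ ∙-cong (prod-word a) (prod-reverse qs) ⟩
      (z ∙ prod C qs) ∙ prod C qs ⁻¹             ≈⟨ //-rightDividesʳ (prod C qs) z ⟩
      z                                          ∎
    last-descent : ∀ bs → Reduced (as′ ++ bs) → prod C (as′ ++ bs) ≈ z → Any (DR C len z) bs
    last-descent bs red eq with initLast bs
    -- If nothing of `reverse qs` survived, `z` would be no longer than `z ∙ prod C qs`.
    ... | [] = contradiction lt (ℕ.≤⇒≯ (ℕ.≤-trans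
      (ℕ.≤-reflexive (≡.trans (len-cong (≈-sym eq))
        (≡.trans (≡.sym red) (cong length (List.++-identityʳ as′)))))
      (ℕ.≤-trans (length-mono-≤ as′⊆) (ℕ.≤-reflexive (length-word a)))))
    ... | bs ∷ʳ′ k = Any.++⁺ʳ bs (here descent)
      where
      z∙k : prod C (as′ ++ bs) ≈ z ∙ gen k
      z∙k = begin
        prod C (as′ ++ bs)                       ≈⟨ ∙gen∙gen _ k ⟨
        (prod C (as′ ++ bs) ∙ gen k) ∙ gen k     ≈⟨ ∙-congʳ (∙-congˡ (prod-[] k)) ⟨
        (prod C (as′ ++ bs) ∙ prod C [ k ]) ∙ gen k ≈⟨ ∙-congʳ (prod-++ (as′ ++ bs) [ k ]) ⟨
        prod C ((as′ ++ bs) ++ [ k ]) ∙ gen k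
          ≡⟨ cong (λ js → prod C js ∙ gen k) (List.++-assoc as′ bs [ k ]) ⟩
        prod C (as′ ++ (bs ∷ʳ k)) ∙ gen k        ≈⟨ ∙-congʳ eq ⟩
        z ∙ gen k                                ∎
      descent : len (z ∙ gen k) < len z
      descent = ℕ.≤-trans (s≤s (len-minimal (as′ ++ bs) z∙k)) (ℕ.≤-reflexive (≡.trans
        (≡.sym (≡.trans (cong length (≡.sym (List.++-assoc as′ bs [ k ])))
                        (≡.trans (List.length-++ (as′ ++ bs)) (ℕ.+-comm _ 1))))
        (≡.trans red (len-cong eq))))

  private
    ∙gen≈ : ∀ w i → ((w ∙ gen i) ∙ w ⁻¹) ∙ w ≈ w ∙ gen i
    ∙gen≈ w i = //-rightDividesˡ w (w ∙ gen i)

  -- Right multiplication of `w` by `gen i` is left multiplication by the reflection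
  -- `(w ∙ gen i) ∙ w ⁻¹`, for which the parity `N` decides.
  ¬DR⇒longer : ∀ {w i} → ¬ DR C len w i → len w < len (w ∙ gen i)
  ¬DR⇒longer {w} {i} ¬d with N w ((w ∙ gen i) ∙ w ⁻¹) in eq
  ... | true  = contradiction (subst (_< len w) (len-cong (∙gen≈ w i)) (N⇒shorter eq)) ¬d
  ... | false = subst (len w <_) (len-cong (∙gen≈ w i)) (¬N⇒longer (∙gen-isReflection w i) eq)

  -- Exchange spells `w ∙ gen j` by a subword of `word w`, so `gen j` is a product of letters of
  -- `word w`. The search for descents thus becomes finite even if `I` is infinite.
  DR⇒∈word : ∀ {w j} → DR C len w j → Any (λ k → gen k ≈ gen j) (word w)
  DR⇒∈word {w} {j} d with strong-exchange (word w) ((w ∙ gen j) ∙ w ⁻¹)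
    (shorter⇒N (∙gen-isReflection w j) (subst (_< len w) (≡.sym (len-cong (∙gen≈ w j))) d))
  ... | ks , ks⊆w , _ , eq = gen-support J-resp (reverse (word w) ++ ks)
    (All.++⁺ (All-reverse all) (All-resp-⊆ ks⊆w all)) gen≈
    where
    open SetoidReasoning setoid
    J : I → Set ℓ
    J l = Any (λ k → gen k ≈ gen l) (word w)
    J-resp : ∀ {i j} → gen i ≈ gen j → J i → J j
    J-resp eq = Any.map (λ p → ≈-trans p eq)
    all : All J (word w)
    all = All.tabulate (Any.map λ { refl → ≈-refl })
    gen≈ : prod C (reverse (word w) ++ ks) ≈ gen j
    gen≈ = begin
      prod C (reverse (word w) ++ ks)         ≈⟨ prod-++ (reverse (word w)) ks ⟩
      prod C (reverse (word w)) ∙ prod C ks   ≈⟨ ∙-cong (prod-reverse (word w)) eq ⟩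
      prod C (word w) ⁻¹ ∙ (((w ∙ gen j) ∙ w ⁻¹) ∙ prod C (word w))
        ≈⟨ ∙-cong (⁻¹-cong (prod-word w)) (∙-congˡ (prod-word w)) ⟩
      w ⁻¹ ∙ (((w ∙ gen j) ∙ w ⁻¹) ∙ w)       ≈⟨ ∙-congˡ (∙gen≈ w j) ⟩
      w ⁻¹ ∙ (w ∙ gen j)                      ≈⟨ \\-leftDividesʳ w (gen j) ⟩
      gen j                                   ∎

  module _ (i : I) where

    OtherDescent : Carrier → I → Set
    OtherDescent v k = k ≢ i × DR C len v k

    minimal : ∀ v → ¬ Any (OtherDescent v) (word v) → MinimalRep C len (SMinus C len i) v
    minimal v none j j≢i = ¬DR⇒longer λ d → none (Any.map
      (λ {k} eq → (λ k≡i → gen-injective eq λ k≡j → j≢i (≡.trans (≡.sym k≡j) k≡i)) ,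
                  subst (_< len v) (len-cong (∙-congˡ (≈-sym eq))) d)
      (DR⇒∈word d))

    -- Right descents other than `i` are stripped from `v` and collected in the parabolic factor
    -- until none is left; `n` bounds the number of rounds.
    decompose-within : ∀ n v → len v ≤ n → ∃ (IsParabolicPart C len (SMinus C len i) v)
    decompose-within n v len≤n
      with Any.any? (λ k → ≢? k i ×-dec (len (v ∙ gen k) <? len v)) (word v)
    ... | no none = v , minimal v none , ε , ([] , [] , ≈-refl) , ≈-sym (identityʳ v) ,
      ≡.sym (≡.trans (cong (len v +_) (ℕ.n≤0⇒n≡0 (len-minimal [] ≈-refl))) (ℕ.+-identityʳ (len v)))
    decompose-within zero v len≤n | yes some with Any.satisfied some
    ... | k , _ , d = contradiction (ℕ.≤-trans d len≤n) λ ()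
    decompose-within (suc n) v len≤n | yes some with Any.satisfied some
    ... | k , k≢i , d with decompose-within n (v ∙ gen k) (s≤s⁻¹ (ℕ.≤-trans d len≤n))
    ... | x , x-minimal , y , (ys , all , eq) , v∙k≈x∙y , lens =
      x , x-minimal , y ∙ gen k ,
      (ys ∷ʳ k , All.++⁺ all (k≢i ∷ []) , ≈-trans (prod-++ ys [ k ]) (∙-cong eq (prod-[] k))) ,
      -- Subadditivity gives one bound. For the other, `y ∙ gen k` has length at most one more than
      -- `y`, while `v ∙ gen k` is strictly shorter than `v`.
      v≈ , ℕ.≤-antisym
        (ℕ.≤-trans (ℕ.≤-reflexive (len-cong v≈)) (len-∙ x (y ∙ gen k)))
        (ℕ.≤-trans (ℕ.+-monoʳ-≤ (len x) (len-∙gen y k))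
          (ℕ.≤-trans (ℕ.≤-reflexive (≡.trans (ℕ.+-suc (len x) (len y)) (cong suc (≡.sym lens)))) d))
      where
      v≈ : v ≈ x ∙ (y ∙ gen k)
      v≈ = ≈-trans (≈-sym (∙gen∙gen v k)) (≈-trans (∙-congʳ v∙k≈x∙y) (assoc x y (gen k)))

    decompose : ∀ v → ∃ (IsParabolicPart C len (SMinus C len i) v)
    decompose v = decompose-within (len v) v ℕ.≤-refl

    SMinus-resp : ∀ {j k} → gen j ≈ gen k → SMinus C len i j → SMinus C len i k
    SMinus-resp eq j≢i refl = gen-injective eq j≢i

  -- By subadditivity `t ∙ v` is no longer than `len (t ∙ x) + len y`, which is less than
  -- `len x + len y`.
  TL-prefix : ∀ {v x y t} → v ≈ x ∙ y → len v ≡ len x + len y → TL C len x t → TL C len v t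
  TL-prefix {v} {x} {y} {t} eq lens (r , lt) = r , subst (len (t ∙ v) <_) (≡.sym lens)
    (ℕ.≤-<-trans (ℕ.≤-trans (ℕ.≤-reflexive (len-cong (≈-trans (∙-congˡ eq) (≈-sym (assoc t x y)))))
                            (len-∙ (t ∙ x) y))
                 (ℕ.+-monoˡ-< (len y) lt))

  N-suffix : ∀ {v x y t} → v ≈ x ∙ y → N v t ≡ true → N x t ≡ false → N y (t ^ x) ≡ true
  N-suffix {v} {x} {y} {t} eq Nv Nx = ≡.trans (cong (_xor N y (t ^ x)) (≡.sym Nx))
    (≡.trans (≡.sym (N-∙ x y t)) (≡.trans (N-cong (≈-sym eq) ≈-refl) Nv))

  TL-parabolic : ∀ {i v t} → IsReflection C t → N v t ≡ true → i ∈ word (t ^ v) →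
                 ∃ λ x → IsParabolicPart C len (SMinus C len i) v x × TL C len x t
  TL-parabolic {i} {v} {t} r Nv i∈ with decompose i v
  ... | x , part@(_ , y , (ys , all , ys≈y) , v≈ , _) with N x t in Nx
  ... | true  = x , part , r , N⇒shorter Nx
  ... | false with strong-exchange ys (t ^ x)
    (≡.trans (≡.sym (N-prod ys (t ^ x) ys≈y)) (N-suffix v≈ Nv Nx))
  -- `ks` spells `t ^ x ∙ y`, so `reverse ys ++ ks` spells `t ^ v` without the letter `i`; by
  -- `support` the reduced word of `t ^ v` avoids `i` as well.
  ... | ks , ks⊆ys , _ , eq = contradiction refl (All.lookup
    (support (SMinus-resp i) (word (t ^ v)) (reverse ys ++ ks) (word-reduced (t ^ v))
      (All.++⁺ (All-reverse all) (All-resp-⊆ ks⊆ys all)) t^v≈) i∈)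
    where
    open SetoidReasoning setoid
    t^v≈ : prod C (word (t ^ v)) ≈ prod C (reverse ys ++ ks)
    t^v≈ = begin
      prod C (word (t ^ v))                  ≈⟨ prod-word (t ^ v) ⟩
      t ^ v                                  ≈⟨ ^-cong ≈-refl v≈ ⟩
      t ^ (x ∙ y)                            ≈⟨ ^-∙ t x y ⟩
      (t ^ x) ^ y                            ≈⟨ ^-cong ≈-refl ys≈y ⟨
      prod C ys ⁻¹ ∙ (t ^ x ∙ prod C ys)     ≈⟨ ∙-cong (prod-reverse ys) eq ⟨
      prod C (reverse ys) ∙ prod C ks        ≈⟨ prod-++ (reverse ys) ks ⟨
      prod C (reverse ys ++ ks)              ∎

  -- Left multiplication of `y` by `t ^ x` equals right multiplication by `t ^ v`, so the word of
  -- `t ^ v` shortens `y` from the right.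
  descent-of-suffix : ∀ {v x y t} → v ≈ x ∙ y → N y (t ^ x) ≡ true →
                      ∃[ i ] i ∈ word (t ^ v) × DR C len y i
  descent-of-suffix {v} {x} {y} {t} v≈ Ny =
    find (descent-in-word y (word (t ^ v)) (subst (_< len y) (len-cong y∙≈) (N⇒shorter Ny)))
    where
    open SetoidReasoning setoid
    y∙≈ : t ^ x ∙ y ≈ y ∙ prod C (word (t ^ v))
    y∙≈ = begin
      t ^ x ∙ y                     ≈⟨ ∙-^ (t ^ x) y ⟨
      y ∙ (t ^ x) ^ y               ≈⟨ ∙-congˡ (^-∙ t x y) ⟨
      y ∙ t ^ (x ∙ y)               ≈⟨ ∙-congˡ (^-cong ≈-refl v≈) ⟨
      y ∙ t ^ v                     ≈⟨ ∙-congˡ (prod-word (t ^ v)) ⟨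
      y ∙ prod C (word (t ^ v))     ∎

-- The two inclusions for left inversion sets.

theorem4p3 : {c ℓ : Level} (C : CoxeterSystem c ℓ)
    (len : Group.Carrier (CoxeterSystem.W C) → ℕ) → IsLengthFunction C len →
    (u v : Group.Carrier (CoxeterSystem.W C)) → _≤R_ C len u v →
    (t : Group.Carrier (CoxeterSystem.W C)) →
    TL C len v t ⇔
    (TL C len u t ⊎
    ∃ λ (i : CoxeterSystem.I C) →
    DR C len (Group._∙_ (CoxeterSystem.W C) (Group._⁻¹ (CoxeterSystem.W C) u) v) i
    × ∃ λ (x : Group.Carrier (CoxeterSystem.W C)) →
    IsParabolicPart C len (SMinus C len i) v x × TL C len x t)
theorem4p3 C len isLen u v u≤v t = mk⇔ to from
  where
  open Group (CoxeterSystem.W C)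
  open GroupProperties (CoxeterSystem.W C)
  open Length C len isLen
  open Parabolic C len isLen

  v≈u∙z : v ≈ u ∙ (u ⁻¹ ∙ v)
  v≈u∙z = Group.sym (CoxeterSystem.W C) (\\-leftDividesˡ u v)

  Right : Set _
  Right = TL C len u t ⊎
    ∃ λ i → DR C len (u ⁻¹ ∙ v) i × ∃ λ x → IsParabolicPart C len (SMinus C len i) v x × TL C len x t

  to : TL C len v t → Right
  to (r , lt) with N u t in Nu
  ... | true  = inj₁ (r , N⇒shorter Nu)
  -- One letter `i` has to serve twice: as a right descent of `u ⁻¹ ∙ v` and as a letter of the word
  -- of `t ^ v`, which `TL-parabolic` asks for.
  ... | false with descent-of-suffix v≈u∙z (N-suffix v≈u∙z (shorter⇒N r lt) Nu)
  ... | i , i∈ , d = inj₂ (i , d , TL-parabolic r (shorter⇒N r lt) i∈)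

  from : Right → TL C len v t
  -- Both `u` and the minimal representative `x` are prefixes of `v` with additive lengths.
  from (inj₁ p) = TL-prefix v≈u∙z u≤v p
  from (inj₂ (_ , _ , x , (_ , y , _ , v≈ , lens) , p)) = TL-prefix v≈ lens p
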